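{- Let $G$ be a connected simple cubic graph of girth 4, let $M(G)$ be a $\Pi$-map of $G$, and let $\mu':V(G)\cup E(G)\to\{0,1,2,3\}$ be a periodic ETGC of $M(G)$ (obtained by the spray rule). Then $\mu'$ has an associated 3-permutation face coloring $\mu$ of $M(G)$ (assigning to the face with belt $B$ the 3-permutation $\mu(B)=abc$, where $0,a,b,c$ are the $\mu'$-colors of four consecutive vertices of $B$ in clockwise order starting at a vertex of color $0$) such that no two adjacent faces of $M(G)$ (i.e. faces sharing an edge) are assigned by $\mu$ the same 3-permutation.
   Context: Write $[3]_0=\{0,1,2,3\}$. $G$ is a connected simple cubic graph of girth 4. A set $S\subseteq V(G)$ is an efficient dominating set (EDS) if $|N_G[v]\cap S|=1$ for every $v\in V(G)$, where $N_G[v]$ is the closed neighborhood. A total coloring (TC) colors vertices and edges so that no two incident or adjacent elements get the same color. An efficient total coloring (ETC) of $G$ is a total coloring $\mu:V(G)\cup E(G)\to[3]_0$ such that for each vertex $v$ the restriction of $\mu$ to $N_G[v]$ is a bijection onto $[3]_0$, and the four vertex color classes partition $V(G)$ into EDSs. An ETGC (efficient total girth coloring) is an ETC in which every 4-cycle of $G$ has each of the four colors exactly once on its vertices and exactly once on its edges. A map $M(G)$ is an embedding of $G$ in a connected closed orientable surface $S$ of genus equal to the genus of $G$ such that the components of $S\setminus G$ are open disks; closures of these disks are the faces, and a belt is a face boundary cycle (an $\ell$-belt if it has length $\ell$). A vertex of $G$ in no 4-cycle of $G$ is a Y-vertex; an edge with both ends Y-vertices is a Y-edge. A $2\ell$-belt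 with consecutive edges $(e_1,\dots,e_{2\ell})$ is a Y-belt if its Y-edges, if any, occur only in opposite pairs $\{e_h,e_{h+\ell}\}$, $1\le h\le\ell$. $M(G)$ is a Y-map if all belts have even length and are Y-belts. A $\Pi$-map is a Y-map $M(G)$ for which $V(G)$ admits a partition into four EDSs, labelled $0,1,2,3$, such that the cyclic sequence of vertex colors of each $\ell$-belt has the form $(a,b,c,d)^{\ell/4}$ with $\{a,b,c,d\}=[3]_0$ (so all belt lengths are divisible by 4). An ETGC is periodic if for each belt, traversed in one of its two directions, the alternating cyclic sequence of colors (vertex, edge, vertex, edge, ...) is a concatenation of copies of $a,b,c,a,d,c,b,d$ for some $\{a,b,c,d\}=[3]_0$ (entries in odd positions being vertex colors and entries in even positions edge colors). Spray rule: at a vertex $v$ with incident edges $e=vv_e$, $f=vv_f$, $g=vv_g$: if $v,e,f$ have colors $c_0,c_1,c_2$, then $g$ gets the remaining color; and if moreover $v_e,v_f$ have colors $d_1,d_2$, then $v_g$ gets the color in $[3]_0\setminus\{c_0,d_1,d_2\}$. A 3-permutation is one of the six permutations $abc$ of $\{1,2,3\}$ written as a word. -}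

module Defs where

open import Data.Fin using (Fin; toℕ; _≟_)
open import Data.Fin.Patterns using (0F; 1F; 2F; 3F)
open import Data.Fin.Subset using (Subset; _∈_; _∉_; _∩_; _∪_; ⁅_⁆; ∣_∣)
open import Data.List as List using (List; []; _∷_; concat; concatMap; reverse; allFin)
open import Data.List.Relation.Binary.Permutation.Propositional using (_↭_)
open import Data.Nat using (ℕ; suc; _+_; _*_; _/_; _≤_; _<_; NonZero)
open import Data.Nat.DivMod using (_mod_)
open import Data.Nat.GeneralisedArithmetic using (iterate)
open import Data.Product using (∃-syntax; _×_; proj₁)
open import Data.Sum using (_⊎_)
import Data.Vec as Vec
open import Function using (_∘_; _⇔_; _↔_; Inverse; Injective; Bijective)
open import Relation.Binary.Construct.Closure.ReflexiveTransitive using (Star)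
open import Relation.Binary.PropositionalEquality using (_≡_; _≢_)
open import Relation.Nullary using (¬_; does)

------------------------------------------------------------------------
-- Graphs

record SimpleGraph (n : ℕ) : Set where
  field
    N     : Fin n → Subset n
    sym   : ∀ {u v} → v ∈ N u → u ∈ N v
    irrfl : ∀ {v} → v ∉ N v

module _ {n : ℕ} (G : SimpleGraph n) where
  open SimpleGraph G

  Adj : Fin n → Fin n → Set
  Adj u v = v ∈ N u

  N[_] : Fin n → Subset n
  N[ v ] = ⁅ v ⁆ ∪ N v

  degree : Fin n → ℕ
  degree v = ∣ N v ∣

  -- The number of edges, by the handshake lemma.
  size : ℕ
  size = List.sum (List.map degree (allFin n)) / 2

  Connected : Set
  Connected = ∀ u v → Star Adj u v

  Cubic : Set
  Cubic = ∀ v → degree v ≡ 3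

  -- An edge with a chosen direction; each edge underlies two darts.
  record Dart : Set where
    constructor dart
    field
      {tail head} : Fin n
      adj         : Adj tail head

  open Dart public

  flip : Dart → Dart
  flip d = dart (sym (adj d))

  next : ∀ {ℓ} .{{_ : NonZero ℓ}} → Fin ℓ → Fin ℓ
  next {ℓ} i = suc (toℕ i) mod ℓ

  record Cycle (ℓ : ℕ) .{{_ : NonZero ℓ}} : Set where
    field
      3≤length  : 3 ≤ ℓ
      vertex    : Fin ℓ → Fin n
      injective : Injective _≡_ _≡_ vertex
      adjacent  : ∀ i → Adj (vertex i) (vertex (next i))

    edge : Fin ℓ → Dart
    edge i = dart (adjacent i)

  Girth : (g : ℕ) .{{_ : NonZero g}} → Set
  Girth g = Cycle g × (∀ ℓ .{{_ : NonZero ℓ}} → Cycle ℓ → g ≤ ℓ)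

  EfficientDominating : Subset n → Set
  EfficientDominating S = ∀ v → ∣ N[ v ] ∩ S ∣ ≡ 1

  YVertex : Fin n → Set
  YVertex v = ¬ (∃[ c ] ∃[ i ] Cycle.vertex {4} c i ≡ v)

  YEdge : Dart → Set
  YEdge d = YVertex (tail d) × YVertex (head d)

------------------------------------------------------------------------
-- Embeddings in closed orientable surfaces

SameOrbit : {A : Set} → (A → A) → A → A → Set
SameOrbit f x y = ∃[ k ] iterate f x k ≡ y

-- A cellular embedding of a connected graph in a closed oriented surface,
-- given by its rotation system: `rotation` sends a dart to the next dart
-- anticlockwise around their common tail.  The faces are the orbits of
-- `φ`, and the genus of the surface is given by Euler's formula
-- n − size + faces = 2 − 2 · genus.  (A one-vertex graph has no dart and
-- hence no embedding in this sense.)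
record Embedding {n : ℕ} (G : SimpleGraph n) : Set where
  field
    rotation       : Dart G ↔ Dart G
    vertices       : ∀ d e → tail d ≡ tail e ⇔ SameOrbit (Inverse.to rotation) d e

  -- Arriving along d, leave by the edge next to d anticlockwise, that is,
  -- turn rightmost: the face kept on the right is traversed clockwise.
  φ : Dart G → Dart G
  φ d = Inverse.to rotation (flip G d)

  field
    faces           : ℕ
    face            : Dart G → Fin faces
    face-surjective : ∀ F → ∃[ d ] face d ≡ F
    face-orbit      : ∀ d e → face d ≡ face e ⇔ SameOrbit φ d e
    genus           : ℕ
    euler           : n + faces + 2 * genus ≡ size G + 2

-- The least genus of a surface in which a connected graph embeds is
-- attained by a cellular embedding, so it suffices to range over these.
IsGenus : ∀ {n} → SimpleGraph n → ℕ → Set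
IsGenus G g = (∃[ E ] Embedding.genus {G = G} E ≡ g)
            × (∀ (E : Embedding G) → g ≤ Embedding.genus E)

record Map {n : ℕ} (G : SimpleGraph n) : Set where
  field
    embedding : Embedding G
  open Embedding embedding public
  field
    genus-of-graph : IsGenus G genus

------------------------------------------------------------------------
-- Colorings

Color : Set
Color = Fin 4

AllColors : List Color → Set
AllColors cs = cs ↭ allFin 4

module _ {n : ℕ} (G : SimpleGraph n) where

  colorClass : (Fin n → Color) → Color → Subset n
  colorClass c i = Vec.tabulate (λ v → does (c v ≟ i))

  -- Partitions of the vertex set into four EDSs labelled 0, 1, 2, 3 are
  -- given by their label function.
  EDSPartition : (Fin n → Color) → Set
  EDSPartition c = ∀ i → EfficientDominating G (colorClass c i)

  record Coloring : Set where
    field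
      vcol      : Fin n → Color
      ecol      : Dart G → Color
      ecol-flip : ∀ d → ecol (flip G d) ≡ ecol d

  module _ (μ : Coloring) where
    open Coloring μ

    record IsTotalColoring : Set where
      field
        vertex-vertex : ∀ (d : Dart G) → vcol (tail d) ≢ vcol (head d)
        vertex-edge   : ∀ (d : Dart G) → vcol (tail d) ≢ ecol d
        edge-edge     : ∀ (d e : Dart G) → tail d ≡ tail e → d ≢ e → ecol d ≢ ecol e

    record IsETC : Set where
      field
        total        : IsTotalColoring
        neighborhood : ∀ v → Bijective _≡_ _≡_ (λ (x : ∃[ u ] u ∈ N[_] G v) → vcol (proj₁ x))
        classes      : EDSPartition vcol

    record IsETGC : Set where
      field
        etc            : IsETC
        cycle-vertices : (c : Cycle G 4) → Bijective _≡_ _≡_ (vcol ∘ Cycle.vertex c)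
        cycle-edges    : (c : Cycle G 4) → Bijective _≡_ _≡_ (ecol ∘ Cycle.edge c)

    SprayRule : Set
    SprayRule = ∀ (e f g : Dart G) → tail e ≡ tail f → tail f ≡ tail g →
                e ≢ f → f ≢ g → e ≢ g →
                AllColors (vcol (tail e) ∷ ecol e ∷ ecol f ∷ ecol g ∷ [])
              × AllColors (vcol (tail e) ∷ vcol (head e) ∷ vcol (head f) ∷ vcol (head g) ∷ [])

------------------------------------------------------------------------
-- Belts

power : {A : Set} → List A → ℕ → List A
power w m = concat (List.replicate m w)

module _ {n : ℕ} {G : SimpleGraph n} (M : Map G) where
  open Map M

  -- The boundary of the face to the right of d, followed clockwise from d
  -- on, is a closed walk of length ℓ.  Its vertices are not required to be
  -- distinct; for a cubic graph this follows from the form of the vertex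
  -- color sequence in IsΠMap.
  record Belt (d : Dart G) (ℓ : ℕ) : Set where
    field
      positive : 0 < ℓ
      closed   : iterate φ d ℓ ≡ d
      once     : ∀ k → 0 < k → k < ℓ → iterate φ d k ≢ d

  clockwise : Dart G → ℕ → List (Dart G)
  clockwise d ℓ = List.iterate φ d ℓ

  anticlockwise : Dart G → ℕ → List (Dart G)
  anticlockwise d ℓ = List.map (flip G) (reverse (clockwise d ℓ))

  YBelt : Dart G → ℕ → Set
  YBelt d ℓ = ∀ h → h < ℓ → YEdge G (iterate φ d h) ⇔ YEdge G (iterate φ d (h + ℓ))

  IsYMap : Set
  IsYMap = ∀ d L → Belt d L → ∃[ ℓ ] L ≡ 2 * ℓ × YBelt d ℓ

  -- Being of the form (a,b,c,d)^m does not depend on the vertex at which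
  -- the cyclic sequence is cut open.
  IsΠMap : Set
  IsΠMap = IsYMap × ∃[ π ] EDSPartition G π ×
    (∀ δ ℓ → Belt δ ℓ →
      ∃[ a ] ∃[ b ] ∃[ c ] ∃[ d ] AllColors (a ∷ b ∷ c ∷ d ∷ []) ×
      ∃[ m ] List.map (π ∘ tail) (clockwise δ ℓ) ≡ power (a ∷ b ∷ c ∷ d ∷ []) m)

  module _ (μ : Coloring G) where
    open Coloring μ

    alternating : List (Dart G) → List Color
    alternating = concatMap (λ d → vcol (tail d) ∷ ecol d ∷ [])

    -- The pattern is stable under rotation by two places.
    PeriodicSequence : List Color → Set
    PeriodicSequence s =
      ∃[ a ] ∃[ b ] ∃[ c ] ∃[ d ] AllColors (a ∷ b ∷ c ∷ d ∷ []) ×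
      ∃[ m ] s ≡ power (a ∷ b ∷ c ∷ a ∷ d ∷ c ∷ b ∷ d ∷ []) m

    IsPeriodic : Set
    IsPeriodic = ∀ δ ℓ → Belt δ ℓ →
      PeriodicSequence (alternating (clockwise δ ℓ)) ⊎
      PeriodicSequence (alternating (anticlockwise δ ℓ))

------------------------------------------------------------------------
-- Face colorings

-- The proof is irrelevant, so 3-permutations are equal as soon as their
-- words are.
record ThreePermutation : Set where
  field
    word   : List Color
    .isPerm : word ↭ 1F ∷ 2F ∷ 3F ∷ []

open ThreePermutation public

module _ {n : ℕ} {G : SimpleGraph n} (M : Map G) where
  open Map M

  FaceColoring : Set
  FaceColoring = Fin faces → ThreePermutation

  -- The first condition says that the second one determines the coloring.
  AssociatedTo : Coloring G → FaceColoring → Set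
  AssociatedTo μ′ μ = ∀ F →
      (∃[ d ] face d ≡ F × vcol (tail d) ≡ 0F)
    × (∀ d → face d ≡ F → vcol (tail d) ≡ 0F →
         List.map (vcol ∘ tail) (clockwise M d 4) ≡ 0F ∷ word (μ F))
    where open Coloring μ′

  OnFace : Dart G → Fin faces → Set
  OnFace e F = face e ≡ F ⊎ face (flip G e) ≡ F

  AdjacentFaces : Fin faces → Fin faces → Set
  AdjacentFaces F F′ = F ≢ F′ × ∃[ e ] OnFace e F × OnFace e F′

  Proper : FaceColoring → Set
  Proper μ = ∀ F F′ → AdjacentFaces F F′ → μ F ≢ μ F′

{-# OPTIONS --safe #-}
module Submission where

-- Along a belt, the periodic pattern makes the vertex colors a cyclic
-- sequence (p,q,r,s)^m with p, q, r, s the four colors, whichever of the two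
-- directions the pattern is read in (vertexColors-periodic).  Hence the colors
-- along the orbit of every dart under φ are rainbow: any four consecutive
-- ones are distinct.  A rainbow sequence has period 4, so in a face the color
-- of a vertex determines the colors of the vertices that follow it clockwise
-- (orbit-window); this makes the associated face coloring well defined.
--
-- Let e = uv lie on the faces F and F′.  As the surface is oriented, the
-- clockwise traversals of F and F′ run through e in opposite directions.  If
-- both faces had the same 3-permutation, then they would have the same cyclic
-- order of colors.  In this order the color of v would succeed that of u
-- because of F, and the color of u would succeed that of v because of F′.
-- The color of u would then recur after two steps, which is impossible in a
-- cyclic order of four distinct colors (no-return).

open import Defs
open import Data.Nat using (ℕ)
open import Data.Product using (∃-syntax; _×_)

open import Data.Fin using (_≟_)
open import Data.Fin.Patterns using (0F)
open import Data.List as List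
  using (List; []; _∷_; _++_; _∷ʳ_; [_]; reverse)
open import Data.List.Membership.Propositional.Properties using (∈-allFin)
open import Data.List.Properties
  using (++-assoc; ++-identityʳ; map-∘; map-++; ∷-injectiveˡ; ∷-injectiveʳ; ∷ʳ-injective;
         reverse-++; reverse-map; reverse-involutive)
open import Data.List.Relation.Binary.Permutation.Propositional
  using (_↭_; prep; ↭-sym; ↭-trans; ↭⇒↭ₛ)
open import Data.List.Relation.Binary.Permutation.Propositional.Properties
  using (drop-∷; ↭-singleton-inv; ∈-resp-↭; ∷↭∷ʳ; ↭-reverse)
import Data.List.Relation.Binary.Permutation.Setoid.Properties as Permutationₛ
import Data.List.Relation.Unary.All as All
open import Data.List.Relation.Unary.AllPairs using (_∷_)
open import Data.List.Relation.Unary.Any using (here; there)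
open import Data.List.Relation.Unary.Unique.Propositional using (Unique)
open import Data.List.Relation.Unary.Unique.Propositional.Properties using (allFin⁺)
open import Data.Nat using (zero; suc; _<_; _<?_; z<s)
open import Data.Nat.GeneralisedArithmetic using (iterate)
open import Data.Nat.Induction using (<-rec)
open import Data.Nat.Properties using (anyUpTo?)
open import Data.Product using (_,_; proj₁; proj₂)
open import Data.Sum using (inj₁; inj₂)
open import Data.Vec.Properties.WithK using ([]=-irrelevant)
open import Function using (_∘_; Equivalence)
open import Relation.Binary using (DecidableEquality)
open import Relation.Binary.PropositionalEquality
  using (_≡_; _≢_; refl; sym; trans; cong; cong₂; subst; setoid; module ≡-Reasoning)
open import Relation.Nullary using (yes; no; contradiction)
open import Relation.Nullary.Decidable using (_×-dec_)

open ≡-Reasoning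

-- Iterates and powers of words

module _ {A : Set} where

  power-comm : (w : List A) (m : ℕ) → power w m ++ w ≡ w ++ power w m
  power-comm w zero    = sym (++-identityʳ w)
  power-comm w (suc m) = begin
    (w ++ power w m) ++ w  ≡⟨ ++-assoc w (power w m) w ⟩
    w ++ (power w m ++ w)  ≡⟨ cong (w ++_) (power-comm w m) ⟩
    w ++ (w ++ power w m)  ∎

  reverse-power : (w : List A) (m : ℕ) → reverse (power w m) ≡ power (reverse w) m
  reverse-power w zero    = refl
  reverse-power w (suc m) = begin
    reverse (w ++ power w m)           ≡⟨ reverse-++ w (power w m) ⟩
    reverse (power w m) ++ reverse w   ≡⟨ cong (_++ reverse w) (reverse-power w m) ⟩
    power (reverse w) m ++ reverse w   ≡⟨ power-comm (reverse w) m ⟩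
    reverse w ++ power (reverse w) m   ∎

  -- Rotating a power rotates its base.
  power-rotate : (x : A) (w : List A) (m : ℕ) →
                 x ∷ power (w ∷ʳ x) m ≡ power (x ∷ w) m ∷ʳ x
  power-rotate x w zero    = refl
  power-rotate x w (suc m) = begin
    x ∷ (w ∷ʳ x) ++ power (w ∷ʳ x) m     ≡⟨ cong (x ∷_) (++-assoc w [ x ] _) ⟩
    (x ∷ w) ++ (x ∷ power (w ∷ʳ x) m)    ≡⟨ cong ((x ∷ w) ++_) (power-rotate x w m) ⟩
    (x ∷ w) ++ (power (x ∷ w) m ∷ʳ x)    ≡⟨ ++-assoc (x ∷ w) (power (x ∷ w) m) [ x ] ⟨
    ((x ∷ w) ++ power (x ∷ w) m) ∷ʳ x    ∎

  iterate-∷ʳ : (f : A → A) (x : A) (n : ℕ) →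
               List.iterate f x (suc n) ≡ List.iterate f x n ∷ʳ iterate f x n
  iterate-∷ʳ f x zero    = refl
  iterate-∷ʳ f x (suc n) = cong (x ∷_) (iterate-∷ʳ f (f x) n)

-- The entries of a list in the odd positions, counted from 1.
odds : {A : Set} → List A → List A
odds (x ∷ _ ∷ xs) = x ∷ odds xs
odds xs           = xs

-- Rainbow sequences

AllColors-unique : ∀ {cs} → AllColors cs → Unique cs
AllColors-unique p = Unique-resp-↭ (↭⇒↭ₛ (↭-sym p)) (allFin⁺ 4)
  where open Permutationₛ (setoid Color) using (Unique-resp-↭)

AllColors-shift : ∀ {p q r s t} → AllColors (p ∷ q ∷ r ∷ s ∷ []) →
                  AllColors (q ∷ r ∷ s ∷ t ∷ []) → t ≡ p
AllColors-shift {p} {q} {r} {s} {t} pqrs qrst =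
  ∷-injectiveˡ (↭-singleton-inv (drop-∷ (drop-∷ (drop-∷ qrst↭qrsp))))
  where
  qrst↭qrsp : q ∷ r ∷ s ∷ t ∷ [] ↭ q ∷ r ∷ s ∷ p ∷ []
  qrst↭qrsp = ↭-trans qrst (↭-trans (↭-sym pqrs) (∷↭∷ʳ p (q ∷ r ∷ s ∷ [])))

-- A color c such that any four consecutive points of an orbit of f have
-- distinct colors.
module Rainbow {A : Set} (f : A → A) (c : A → Color)
               (rainbow : ∀ x → AllColors (List.map c (List.iterate f x 4))) where

  -- The colors of four consecutive points of an orbit, starting at x.
  window : A → List Color
  window x = List.map c (List.iterate f x 4)

  period : ∀ x → c (f (f (f (f x)))) ≡ c x
  period x = AllColors-shift (rainbow x) (rainbow (f x))

  no-return : ∀ x → c (f (f x)) ≢ c x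
  no-return x eq with (_ All.∷ x≢f²x All.∷ _) ∷ _ ← AllColors-unique (rainbow x) =
    x≢f²x (sym eq)

  occurs : ∀ x i → ∃[ k ] c (iterate f x k) ≡ i
  occurs x i with ∈-resp-↭ (↭-sym (rainbow x)) (∈-allFin i)
  ... | here eq                         = 0 , sym eq
  ... | there (here eq)                 = 1 , sym eq
  ... | there (there (here eq))         = 2 , sym eq
  ... | there (there (there (here eq))) = 3 , sym eq

  window-period : ∀ x → window (f (f (f (f x)))) ≡ window x
  window-period x =
    cong₂ _∷_ (period x) (cong₂ _∷_ (period (f x))
      (cong₂ _∷_ (period (f (f x))) (cong [_] (period (f (f (f x)))))))

  window-step : ∀ x y → window x ≡ window y → window (f x) ≡ window (f y)
  window-step x y eq =
    cong₂ _++_ (∷-injectiveʳ eq)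
      (cong [_] (trans (period x) (trans (∷-injectiveˡ eq) (sym (period y)))))

  window-iterate : ∀ k x y → window x ≡ window y →
                   window (iterate f x k) ≡ window (iterate f y k)
  window-iterate zero    x y eq = eq
  window-iterate (suc k) x y eq = window-iterate k (f x) (f y) (window-step x y eq)

  -- Within an orbit, a color determines the colors that follow it: points of
  -- the same color are a multiple of 4 steps apart.
  orbit-window : ∀ k x → c (iterate f x k) ≡ c x → window (iterate f x k) ≡ window x
  orbit-window 0 x _ = refl
  orbit-window 1 x eq with (x≢fx All.∷ _) ∷ _ ← AllColors-unique (rainbow x) =
    contradiction (sym eq) x≢fx
  orbit-window 2 x eq = contradiction eq (no-return x)
  orbit-window 3 x eq
    with (_ All.∷ _ All.∷ x≢f³x All.∷ _) ∷ _ ← AllColors-unique (rainbow x) =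
    contradiction (sym eq) x≢f³x
  orbit-window (suc (suc (suc (suc k)))) x eq =
    trans (orbit-window k (f (f (f (f x)))) (trans eq (sym (period x)))) (window-period x)

-- Darts and belts

module _ {n : ℕ} (G : SimpleGraph n) where

  _≟ᵈ_ : DecidableEquality (Dart G)
  dart {t} {h} a ≟ᵈ dart {t′} {h′} a′ with t ≟ t′ | h ≟ h′
  ... | yes refl | yes refl = yes (cong dart ([]=-irrelevant a a′))
  ... | no  t≢t′ | _        = no (t≢t′ ∘ cong tail)
  ... | yes _    | no  h≢h′ = no (h≢h′ ∘ cong head)

module _ {n : ℕ} {G : SimpleGraph n} (M : Map G) where
  open Map M

  tail-φ : ∀ d → tail (φ d) ≡ head d
  tail-φ d = sym (Equivalence.from (vertices (flip G d) (φ d)) (1 , refl))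

  face-φ : ∀ d → face (φ d) ≡ face d
  face-φ d = sym (Equivalence.from (face-orbit d (φ d)) (1 , refl))

  -- If d returns to itself after some positive number of steps, then its least
  -- positive return time is the length of a belt.
  belt-upTo : ∀ ℓ d → 0 < ℓ → iterate φ d ℓ ≡ d → ∃[ k ] Belt M d k
  belt-upTo ℓ d = <-rec P step ℓ
    where
    P : ℕ → Set
    P ℓ = 0 < ℓ → iterate φ d ℓ ≡ d → ∃[ k ] Belt M d k
    step : ∀ ℓ → (∀ {k} → k < ℓ → P k) → P ℓ
    step ℓ rec 0<ℓ closed with anyUpTo? (λ k → (0 <? k) ×-dec _≟ᵈ_ G (iterate φ d k) d) ℓ
    ... | yes (k , k<ℓ , 0<k , eq) = rec k<ℓ 0<k eq
    ... | no  none = ℓ , record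
      { positive = 0<ℓ
      ; closed   = closed
      ; once     = λ k 0<k k<ℓ eq → none (k , k<ℓ , 0<k , eq)
      }

  -- As d and φ d lie on the same face, some power of φ takes φ d back to d.
  belt : ∀ d → ∃[ ℓ ] Belt M d ℓ
  belt d with k , eq ← Equivalence.to (face-orbit (φ d) d) (face-φ d) =
    belt-upTo (suc k) d z<s eq

-- Vertex colors along belts

  module _ (μ′ : Coloring G) where
    open Coloring μ′

    -- The colors of the vertices met along a walk, each taken at the tail of a dart.
    vertexColors : List (Dart G) → List Color
    vertexColors = List.map (vcol ∘ tail)

    odds-alternating : ∀ ds → odds (alternating M μ′ ds) ≡ vertexColors ds
    odds-alternating []       = refl
    odds-alternating (d ∷ ds) = cong (vcol (tail d) ∷_) (odds-alternating ds)

    odds-pattern : ∀ (a b c d : Color) m →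
                   odds (power (a ∷ b ∷ c ∷ a ∷ d ∷ c ∷ b ∷ d ∷ []) m)
                   ≡ power (a ∷ c ∷ d ∷ b ∷ []) m
    odds-pattern a b c d zero    = refl
    odds-pattern a b c d (suc m) =
      cong (λ cs → a ∷ c ∷ d ∷ b ∷ cs) (odds-pattern a b c d m)

    -- The heads of consecutive darts are the tails of their successors.
    map-head : ∀ d k → List.map (vcol ∘ head) (clockwise M d k)
                       ≡ vertexColors (clockwise M (φ d) k)
    map-head d zero    = refl
    map-head d (suc k) = cong₂ _∷_ (cong vcol (sym (tail-φ d))) (map-head (φ d) k)

    vertexColors-anticlockwise : ∀ d ℓ →
      vertexColors (anticlockwise M d ℓ) ≡ reverse (vertexColors (clockwise M (φ d) ℓ))
    vertexColors-anticlockwise d ℓ = begin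
      vertexColors (List.map (flip G) (reverse ds))     ≡⟨ map-∘ {g = vcol ∘ tail} {f = flip G} (reverse ds) ⟨
      List.map (vcol ∘ head) (reverse ds)               ≡⟨ reverse-map (vcol ∘ head) ds ⟩
      reverse (List.map (vcol ∘ head) ds)               ≡⟨ cong reverse (map-head d ℓ) ⟩
      reverse (vertexColors (clockwise M (φ d) ℓ))      ∎
      where ds = clockwise M d ℓ

    vertexColors-closed : ∀ d k → iterate φ d (suc k) ≡ d →
      vertexColors (clockwise M (φ d) (suc k))
      ≡ vertexColors (clockwise M (φ d) k) ∷ʳ vcol (tail d)
    vertexColors-closed d k closed = begin
      vertexColors (clockwise M (φ d) (suc k))
        ≡⟨ cong vertexColors (iterate-∷ʳ φ (φ d) k) ⟩
      vertexColors (clockwise M (φ d) k ∷ʳ iterate φ (φ d) k)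
        ≡⟨ cong (λ e → vertexColors (clockwise M (φ d) k ∷ʳ e)) closed ⟩
      vertexColors (clockwise M (φ d) k ∷ʳ d)
        ≡⟨ map-++ (vcol ∘ tail) (clockwise M (φ d) k) [ d ] ⟩
      vertexColors (clockwise M (φ d) k) ∷ʳ vcol (tail d)
        ∎

    alternating-vertexColors : ∀ (a b c d : Color) m ds →
      alternating M μ′ ds ≡ power (a ∷ b ∷ c ∷ a ∷ d ∷ c ∷ b ∷ d ∷ []) m →
      vertexColors ds ≡ power (a ∷ c ∷ d ∷ b ∷ []) m
    alternating-vertexColors a b c d m ds eq =
      trans (sym (odds-alternating ds)) (trans (cong odds eq) (odds-pattern a b c d m))

    -- A pattern read anticlockwise starts with the color of the tail of δ and
    -- then follows the belt backwards; reversing it and rotating it by one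
    -- place gives the clockwise sequence.
    vertexColors-periodic : IsPeriodic M μ′ → ∀ δ ℓ → Belt M δ ℓ →
      ∃[ p ] ∃[ q ] ∃[ r ] ∃[ s ] AllColors (p ∷ q ∷ r ∷ s ∷ []) ×
      ∃[ m ] vertexColors (clockwise M δ ℓ) ≡ power (p ∷ q ∷ r ∷ s ∷ []) m
    vertexColors-periodic periodic δ ℓ β with periodic δ ℓ β
    ... | inj₁ (a , b , c , d , abcd , m , eq) =
      a , c , d , b ,
      ↭-trans (prep a (↭-sym (∷↭∷ʳ b (c ∷ d ∷ [])))) abcd ,
      m , alternating-vertexColors a b c d m (clockwise M δ ℓ) eq
    vertexColors-periodic periodic δ zero    record { positive = () } | inj₂ _
    vertexColors-periodic periodic δ (suc k) β
      | inj₂ (a , b , c , d , abcd , m , eq) =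
      a , b , d , c ,
      ↭-trans (prep a (prep b (↭-reverse (c ∷ d ∷ [])))) abcd ,
      m , trans (cong (_∷ xs) (proj₂ split)) (proj₁ split)
      where
      xs : List Color
      xs = vertexColors (clockwise M (φ δ) k)

      backwards : xs ∷ʳ vcol (tail δ) ≡ power (b ∷ d ∷ c ∷ a ∷ []) m
      backwards = begin
        xs ∷ʳ vcol (tail δ)
          ≡⟨ vertexColors-closed δ k (Belt.closed β) ⟨
        vertexColors (clockwise M (φ δ) (suc k))
          ≡⟨ reverse-involutive _ ⟨
        reverse (reverse (vertexColors (clockwise M (φ δ) (suc k))))
          ≡⟨ cong reverse (vertexColors-anticlockwise δ (suc k)) ⟨
        reverse (vertexColors (anticlockwise M δ (suc k)))
          ≡⟨ cong reverse (alternating-vertexColors a b c d m (anticlockwise M δ (suc k)) eq) ⟩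
        reverse (power (a ∷ c ∷ d ∷ b ∷ []) m)
          ≡⟨ reverse-power (a ∷ c ∷ d ∷ b ∷ []) m ⟩
        power (b ∷ d ∷ c ∷ a ∷ []) m
          ∎

      split : a ∷ xs ≡ power (a ∷ b ∷ d ∷ c ∷ []) m × vcol (tail δ) ≡ a
      split = ∷ʳ-injective (a ∷ xs) (power (a ∷ b ∷ d ∷ c ∷ []) m)
        (trans (cong (a ∷_) backwards) (power-rotate a (b ∷ d ∷ c ∷ []) m))

    vertexColors-prefix : ∀ {p q r s} δ ℓ m → 0 < ℓ →
      vertexColors (clockwise M δ ℓ) ≡ power (p ∷ q ∷ r ∷ s ∷ []) m →
      vertexColors (clockwise M δ 4) ≡ p ∷ q ∷ r ∷ s ∷ []
    vertexColors-prefix δ 0 m () eq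
    vertexColors-prefix δ (suc ℓ) 0 _ ()
    vertexColors-prefix δ 1 (suc m) _ ()
    vertexColors-prefix δ 2 (suc m) _ ()
    vertexColors-prefix δ 3 (suc m) _ ()
    vertexColors-prefix δ (suc (suc (suc (suc ℓ)))) (suc m) _ eq = cong (List.take 4) eq

    rainbow-belts : IsPeriodic M μ′ → ∀ d → AllColors (vertexColors (clockwise M d 4))
    rainbow-belts periodic d
      with ℓ , β ← belt d
      with p , q , r , s , pqrs , m , eq ← vertexColors-periodic periodic d ℓ β =
      subst AllColors (sym (vertexColors-prefix d ℓ m (Belt.positive β) eq)) pqrs

-- The face coloring

    module FaceColors (periodic : IsPeriodic M μ′) where
      open Rainbow φ (vcol ∘ tail) (rainbow-belts periodic)

      face-iterate : ∀ d k → face (iterate φ d k) ≡ face d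
      face-iterate d k = sym (Equivalence.from (face-orbit d (iterate φ d k)) (k , refl))

      same-window : ∀ d e → face d ≡ face e → vcol (tail e) ≡ vcol (tail d) →
                    window e ≡ window d
      same-window d e F≡ c≡ with k , refl ← Equivalence.to (face-orbit d e) F≡ =
        orbit-window k d c≡

      -- Only the two stated properties of this dart matter; unfolding it would
      -- compute a belt.
      abstract
        zeroDart : ∀ F → ∃[ d ] face d ≡ F × vcol (tail d) ≡ 0F
        zeroDart F =
          let d , dF = face-surjective F
              k , eq = occurs d 0F
          in iterate φ d k , trans (face-iterate d k) dF , eq

      window-zero : ∀ d → vcol (tail d) ≡ 0F →
                    window d ≡ 0F ∷ vertexColors (clockwise M (φ d) 3)
      window-zero d eq = cong (_∷ vertexColors (clockwise M (φ d) 3)) eq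

      -- The associated 3-permutation, read off from a chosen vertex of color 0
      -- on the face; by same-window it does not depend on the choice.
      faceColor : FaceColoring M
      faceColor F =
        let d , _ , d0 = zeroDart F in record
        { word   = vertexColors (clockwise M (φ d) 3)
        ; isPerm = drop-∷ (subst AllColors (window-zero d d0) (rainbow-belts periodic d))
        }

      associated : AssociatedTo M μ′ faceColor
      proj₁ (associated F) = zeroDart F
      proj₂ (associated F) e eF e0 =
        let d , dF , d0 = zeroDart F in
        trans (same-window d e (trans dF (sym eF)) (trans e0 (sym d0))) (window-zero d d0)

      -- If two faces have the same 3-permutation, then each window of one
      -- occurs on the other.
      transfer : ∀ e F → faceColor (face e) ≡ faceColor F →
                 ∃[ d ] face d ≡ F × window d ≡ window e
      transfer e F eq = iterate φ y k , trans (face-iterate y k) yF , (begin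
          window (iterate φ y k)   ≡⟨ window-iterate k y x y≈x ⟩
          window (iterate φ x k)   ≡⟨ cong window (proj₂ x⇝e) ⟩
          window e                 ∎)
        where
        x y : Dart G
        x = proj₁ (zeroDart (face e))
        y = proj₁ (zeroDart F)

        yF : face y ≡ F
        yF = proj₁ (proj₂ (zeroDart F))

        x⇝e : SameOrbit φ x e
        x⇝e = Equivalence.to (face-orbit x e) (proj₁ (proj₂ (zeroDart (face e))))

        k : ℕ
        k = proj₁ x⇝e

        y≈x : window y ≡ window x
        y≈x = begin
          window y                 ≡⟨ window-zero y (proj₂ (proj₂ (zeroDart F))) ⟩
          0F ∷ word (faceColor F)  ≡⟨ cong (λ μ → 0F ∷ word μ) eq ⟨
          0F ∷ word (faceColor (face e))
            ≡⟨ window-zero x (proj₂ (proj₂ (zeroDart (face e)))) ⟨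
          window x                 ∎

      -- On the face of flip e, the dart d has the colors of e, so φ d and
      -- flip e both have the color of the head of e; the next color is that
      -- of the tail of e, which is the color of d.
      distinct-across : ∀ e → faceColor (face e) ≢ faceColor (face (flip G e))
      distinct-across e eq = no-return d (begin
          vcol (tail (φ (φ d)))          ≡⟨ ∷-injectiveˡ (∷-injectiveʳ φd≈flip) ⟩
          vcol (tail (φ (flip G e)))     ≡⟨ cong vcol (tail-φ (flip G e)) ⟩
          vcol (tail e)                  ≡⟨ ∷-injectiveˡ d≈e ⟨
          vcol (tail d)                  ∎)
        where
        match : ∃[ d ] face d ≡ face (flip G e) × window d ≡ window e
        match = transfer e (face (flip G e)) eq

        d : Dart G
        d = proj₁ match

        d≈e : window d ≡ window e
        d≈e = proj₂ (proj₂ match)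

        φd≈flip : window (φ d) ≡ window (flip G e)
        φd≈flip = same-window (flip G e) (φ d)
          (sym (trans (face-φ d) (proj₁ (proj₂ match))))
          (trans (∷-injectiveˡ (∷-injectiveʳ d≈e)) (cong vcol (tail-φ e)))

      proper : Proper M faceColor
      proper F F′ (F≢F′ , e , inj₁ refl , inj₁ refl) _  = F≢F′ refl
      proper F F′ (F≢F′ , e , inj₁ refl , inj₂ refl) eq = distinct-across e eq
      proper F F′ (F≢F′ , e , inj₂ refl , inj₁ refl) eq = distinct-across e (sym eq)
      proper F F′ (F≢F′ , e , inj₂ refl , inj₂ refl) _  = F≢F′ refl

theorem31 : ∀ {n : ℕ} (G : SimpleGraph n) →
    Connected G → Cubic G → Girth G 4 →
    (M : Map G) → IsΠMap M →
    (μ′ : Coloring G) → IsETGC G μ′ → IsPeriodic M μ′ → SprayRule G μ′ →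
    ∃[ μ ] AssociatedTo M μ′ μ × Proper M μ
theorem31 G _ _ _ M _ μ′ _ periodic _ = faceColor , associated , proper
  where open FaceColors M μ′ periodic
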